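{- No deterministic online algorithm for the General Online Unbounded Knapsack Problem with Removal can have a (strict) competitive ratio of less than $S_\infty$, where $S_\infty=\sum_{n=1}^{\infty}\frac{1}{a_n-1}$.
   Context: Problem. An instance of the General Online Unbounded Knapsack Problem with Removal is a finite sequence of items $I=(x_1,\dots,x_n)$, where an item $x=(w,v)$ has a weight $w(x)=w\in(0,1]$ and a value $v(x)=v\in\mathbb{R}_{>0}$ (weights and values are arbitrary). A solution is a finite multiset $S$ of items from $I$ (each item may appear arbitrarily often) with $\sum_{x\in S}w(x)\le 1$; its gain is $v(S)=\sum_{x\in S}v(x)$. $\mathrm{Opt}(I)$ denotes a solution to $I$ of maximum gain. Online algorithms. An online algorithm maintains a solution ("knapsack"), initially empty. Items arrive one by one in order; when an item $x$ arrives, the algorithm, knowing only the items received so far (in particular not knowing the number of items or any future item), may add any number of copies of $x$ and then remove an arbitrary sub-multiset, such that the knapsack is again a valid solution. $\mathrm{Alg}(I)$ denotes the solution held by the algorithm after all of $I$ has been processed. Competitive ratio. A deterministic algorithm Alg is (strictly) $c$-competitive, for a constant $c\ge 1$, if $c\cdot v(\mathrm{Alg}(I))\ge v(\mathrm{Opt}(I))$ for every instance $I$. Its (strict) competitive ratio is the infimum of all $c\ge1$ for which it is $c$-competitive (and $\infty$ if there is no such $c$). The sequence $(a_n)_{n\ge1}$ (Sylvester's sequence) is defined by $a_1=2$ and $a_n=1+\prod_{i=1}^{n-1}a_i$ for $n\ge2$. -}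

module Defs where

open import Data.Integer.Base using (+_)
import Data.Integer.Base as ℤ
import Data.Integer.Properties as ℤ
open import Data.Integer.Solver using () renaming (module +-*-Solver to ℤ-Solver)
open import Data.Nat.Base as ℕ using (ℕ; zero; suc)
import Data.Nat.Properties as ℕ
open import Data.Product.Base using (∃-syntax; _×_; _,_)
open import Data.Rational.Base as ℚ using (ℚ; mkℚ; 0ℚ; 1ℚ; ½; _/_; ∣_∣; positive; nonNegative; *<*)
import Data.Rational.Properties as ℚ
open import Data.Rational.Solver using (module +-*-Solver)
import Data.Rational.Unnormalised.Base as ℚᵘ
import Data.Rational.Unnormalised.Properties as ℚᵘ
open import Data.Sum.Base using (inj₁; inj₂)
open import Data.Vec.Base using (Vec; []; _∷_; _∷ʳ_)
open import Data.Vec.Relation.Binary.Pointwise.Inductive using (Pointwise)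
open import Relation.Binary.PropositionalEquality
  using (_≡_; refl; sym; cong; cong₂; subst; subst₂; module ≡-Reasoning)
open import Relation.Nullary.Negation using (¬_)

------------------------------------------------------------------------
-- Real numbers, as Cauchy sequences of rationals.  The order is
-- invariant under the usual equivalence of Cauchy sequences, so no
-- quotient is needed.

Cauchy : (ℕ → ℚ) → Set
Cauchy s = ∀ ε → 0ℚ ℚ.< ε →
  ∃[ N ] (∀ m n → N ℕ.≤ m → N ℕ.≤ n → ∣ s m ℚ.- s n ∣ ℚ.< ε)

record ℝ : Set where
  constructor mkℝ
  field
    seq    : ℕ → ℚ
    cauchy : Cauchy seq

open ℝ public

infix 4 _<_ _≤_

_<_ : ℝ → ℝ → Set
x < y = ∃[ ε ] (0ℚ ℚ.< ε × ∃[ N ] (∀ n → N ℕ.≤ n → seq x n ℚ.+ ε ℚ.≤ seq y n))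

_≤_ : ℝ → ℝ → Set
x ≤ y = ¬ (y < x)

private
  0<½* : ∀ {ε} → 0ℚ ℚ.< ε → 0ℚ ℚ.< ½ ℚ.* ε
  0<½* 0<ε = ℚ.*-monoʳ-<-pos ½ 0<ε

  ½+½ : ∀ ε → ½ ℚ.* ε ℚ.+ ½ ℚ.* ε ≡ ε
  ½+½ = solve 1 (λ ε → con ½ :* ε :+ con ½ :* ε := ε) refl
    where open +-*-Solver

  const-cauchy : ∀ q → Cauchy (λ _ → q)
  const-cauchy q ε 0<ε = 0 , λ _ _ _ _ → subst (ℚ._< ε) (sym (cong ∣_∣ (ℚ.+-inverseʳ q))) 0<ε

  +-cauchy : ∀ {s t} → Cauchy s → Cauchy t → Cauchy (λ n → s n ℚ.+ t n)
  +-cauchy {s} {t} cs ct ε 0<ε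
    with M , hM ← cs (½ ℚ.* ε) (0<½* 0<ε)
    with N , hN ← ct (½ ℚ.* ε) (0<½* 0<ε)
    = M ℕ.+ N , λ m n M+N≤m M+N≤n → begin-strict
      ∣ (s m ℚ.+ t m) ℚ.- (s n ℚ.+ t n) ∣      ≡⟨ cong ∣_∣ (rearrange (s m) (t m) (s n) (t n)) ⟩
      ∣ (s m ℚ.- s n) ℚ.+ (t m ℚ.- t n) ∣      ≤⟨ ℚ.∣p+q∣≤∣p∣+∣q∣ (s m ℚ.- s n) (t m ℚ.- t n) ⟩
      ∣ s m ℚ.- s n ∣ ℚ.+ ∣ t m ℚ.- t n ∣
        <⟨ ℚ.+-mono-< (hM m n (ℕ.m+n≤o⇒m≤o M M+N≤m) (ℕ.m+n≤o⇒m≤o M M+N≤n))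
                      (hN m n (ℕ.m+n≤o⇒n≤o M M+N≤m) (ℕ.m+n≤o⇒n≤o M M+N≤n)) ⟩
      ½ ℚ.* ε ℚ.+ ½ ℚ.* ε                      ≡⟨ ½+½ ε ⟩
      ε                                        ∎
    where
    open ℚ.≤-Reasoning
    rearrange : ∀ a b c d → (a ℚ.+ b) ℚ.- (c ℚ.+ d) ≡ (a ℚ.- c) ℚ.+ (b ℚ.- d)
    rearrange = solve 4 (λ a b c d → (a :+ b) :- (c :+ d) := (a :- c) :+ (b :- d)) refl
      where open +-*-Solver

  0<1 : 0ℚ ℚ.< 1ℚ
  0<1 = ℚ.positive⁻¹ 1ℚ

  eventually-bounded : ∀ {s} → Cauchy s →
    ∃[ B ] (0ℚ ℚ.< B × ∃[ N ] (∀ n → N ℕ.≤ n → ∣ s n ∣ ℚ.≤ B))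
  eventually-bounded {s} cs with N , h ← cs 1ℚ 0<1 =
    1ℚ ℚ.+ ∣ s N ∣ ,
    ℚ.+-mono-<-≤ 0<1 (ℚ.0≤∣p∣ (s N)) ,
    N , λ n N≤n → begin
      ∣ s n ∣                        ≡⟨ cong ∣_∣ (split (s n) (s N)) ⟩
      ∣ (s n ℚ.- s N) ℚ.+ s N ∣      ≤⟨ ℚ.∣p+q∣≤∣p∣+∣q∣ (s n ℚ.- s N) (s N) ⟩
      ∣ s n ℚ.- s N ∣ ℚ.+ ∣ s N ∣    ≤⟨ ℚ.+-monoˡ-≤ ∣ s N ∣ (ℚ.<⇒≤ (h n N N≤n ℕ.≤-refl)) ⟩
      1ℚ ℚ.+ ∣ s N ∣                 ∎
    where
    open ℚ.≤-Reasoning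
    split : ∀ a b → a ≡ (a ℚ.- b) ℚ.+ b
    split = solve 2 (λ a b → a := (a :- b) :+ b) refl
      where open +-*-Solver

  -- A positive δ that B scales to exactly ½ ε.
  scale : ∀ {B ε} → 0ℚ ℚ.< B → 0ℚ ℚ.< ε → ∃[ δ ] (0ℚ ℚ.< δ × B ℚ.* δ ≡ ½ ℚ.* ε)
  scale {B} {ε} 0<B 0<ε = 1/B ℚ.* (½ ℚ.* ε) ,
    subst (ℚ._< 1/B ℚ.* (½ ℚ.* ε)) (ℚ.*-zeroʳ 1/B) (ℚ.*-monoʳ-<-pos 1/B (0<½* 0<ε)) ,
    (begin
      B ℚ.* (1/B ℚ.* (½ ℚ.* ε))    ≡⟨ ℚ.*-assoc B 1/B (½ ℚ.* ε) ⟨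
      (B ℚ.* 1/B) ℚ.* (½ ℚ.* ε)    ≡⟨ cong (ℚ._* (½ ℚ.* ε)) (ℚ.*-inverseʳ B) ⟩
      1ℚ ℚ.* (½ ℚ.* ε)             ≡⟨ ℚ.*-identityˡ (½ ℚ.* ε) ⟩
      ½ ℚ.* ε                      ∎)
    where
    open ≡-Reasoning
    instance
      B-pos : ℚ.Positive B
      B-pos = positive 0<B
      B-nonZero : ℚ.NonZero B
      B-nonZero = ℚ.pos⇒nonZero B
    1/B : ℚ
    1/B = ℚ.1/ B
    instance
      1/B-pos : ℚ.Positive 1/B
      1/B-pos = ℚ.1/pos⇒pos B

  *-mono-∣∣ : ∀ {B δ} p q → ∣ p ∣ ℚ.≤ B → 0ℚ ℚ.< B → ∣ q ∣ ℚ.< δ → ∣ p ℚ.* q ∣ ℚ.< B ℚ.* δ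
  *-mono-∣∣ {B} {δ} p q p≤B 0<B q<δ = begin-strict
    ∣ p ℚ.* q ∣        ≡⟨ ℚ.∣p*q∣≡∣p∣*∣q∣ p q ⟩
    ∣ p ∣ ℚ.* ∣ q ∣    ≤⟨ ℚ.*-monoʳ-≤-nonNeg ∣ q ∣ {{nonNegative (ℚ.0≤∣p∣ q)}} p≤B ⟩
    B ℚ.* ∣ q ∣        <⟨ ℚ.*-monoʳ-<-pos B {{positive 0<B}} q<δ ⟩
    B ℚ.* δ            ∎
    where open ℚ.≤-Reasoning

  *-rearrange : ∀ a b c d → a ℚ.* b ℚ.- c ℚ.* d ≡ a ℚ.* (b ℚ.- d) ℚ.+ d ℚ.* (a ℚ.- c)
  *-rearrange = solve 4 (λ a b c d → a :* b :- c :* d := a :* (b :- d) :+ d :* (a :- c)) refl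
    where open +-*-Solver

  *-close : ∀ {B C δ η ε} a b c d →
    ∣ a ∣ ℚ.≤ B → 0ℚ ℚ.< B → ∣ b ℚ.- d ∣ ℚ.< δ → B ℚ.* δ ≡ ½ ℚ.* ε →
    ∣ d ∣ ℚ.≤ C → 0ℚ ℚ.< C → ∣ a ℚ.- c ∣ ℚ.< η → C ℚ.* η ≡ ½ ℚ.* ε →
    ∣ a ℚ.* b ℚ.- c ℚ.* d ∣ ℚ.< ε
  *-close {B} {C} {δ} {η} {ε} a b c d a≤B 0<B b-d<δ Bδ d≤C 0<C a-c<η Cη = begin-strict
    ∣ a ℚ.* b ℚ.- c ℚ.* d ∣                              ≡⟨ cong ∣_∣ (*-rearrange a b c d) ⟩
    ∣ a ℚ.* (b ℚ.- d) ℚ.+ d ℚ.* (a ℚ.- c) ∣              ≤⟨ ℚ.∣p+q∣≤∣p∣+∣q∣ (a ℚ.* (b ℚ.- d)) (d ℚ.* (a ℚ.- c)) ⟩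
    ∣ a ℚ.* (b ℚ.- d) ∣ ℚ.+ ∣ d ℚ.* (a ℚ.- c) ∣          <⟨ ℚ.+-mono-< (*-mono-∣∣ a (b ℚ.- d) a≤B 0<B b-d<δ)
                                                                       (*-mono-∣∣ d (a ℚ.- c) d≤C 0<C a-c<η) ⟩
    B ℚ.* δ ℚ.+ C ℚ.* η                                  ≡⟨ cong₂ ℚ._+_ Bδ Cη ⟩
    ½ ℚ.* ε ℚ.+ ½ ℚ.* ε                                  ≡⟨ ½+½ ε ⟩
    ε                                                    ∎
    where open ℚ.≤-Reasoning

  *-cauchy : ∀ {s t} → Cauchy s → Cauchy t → Cauchy (λ n → s n ℚ.* t n)
  *-cauchy {s} {t} cs ct ε 0<ε =
    let B , 0<B , K , hK = eventually-bounded cs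
        C , 0<C , L , hL = eventually-bounded ct
        δ , 0<δ , Bδ = scale 0<B 0<ε
        η , 0<η , Cη = scale 0<C 0<ε
        M , hM = ct δ 0<δ
        N , hN = cs η 0<η
    in (K ℕ.+ L) ℕ.+ (M ℕ.+ N) , λ m n ≤m ≤n →
      let KL≤m = ℕ.m+n≤o⇒m≤o (K ℕ.+ L) ≤m
          KL≤n = ℕ.m+n≤o⇒m≤o (K ℕ.+ L) ≤n
          MN≤m = ℕ.m+n≤o⇒n≤o (K ℕ.+ L) ≤m
          MN≤n = ℕ.m+n≤o⇒n≤o (K ℕ.+ L) ≤n
      in *-close {B} {C} {δ} {η} {ε} (s m) (t m) (s n) (t n)
           (hK m (ℕ.m+n≤o⇒m≤o K KL≤m)) 0<B
           (hM m n (ℕ.m+n≤o⇒m≤o M MN≤m) (ℕ.m+n≤o⇒m≤o M MN≤n)) Bδ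
           (hL n (ℕ.m+n≤o⇒n≤o K KL≤n)) 0<C
           (hN m n (ℕ.m+n≤o⇒n≤o M MN≤m) (ℕ.m+n≤o⇒n≤o M MN≤n)) Cη

fromℚ : ℚ → ℝ
fromℚ q = mkℝ (λ _ → q) (const-cauchy q)

0ℝ 1ℝ : ℝ
0ℝ = fromℚ 0ℚ
1ℝ = fromℚ 1ℚ

infixl 6 _+_
infixl 7 _*_

_+_ : ℝ → ℝ → ℝ
x + y = mkℝ (λ n → seq x n ℚ.+ seq y n) (+-cauchy {seq x} {seq y} (cauchy x) (cauchy y))

_*_ : ℝ → ℝ → ℝ
x * y = mkℝ (λ n → seq x n ℚ.* seq y n) (*-cauchy {seq x} {seq y} (cauchy x) (cauchy y))

fromℕ : ℕ → ℝ
fromℕ k = fromℚ (+ k / 1)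

------------------------------------------------------------------------
-- Extended upper reals: a possibly empty upper cut of rationals.  Unlike
-- in ℝ, every set of reals has an infimum here, constructively; the
-- infimum of the empty set is the empty cut, which is ∞ (and the cut of
-- all rationals is -∞).

record ℝ∞ : Set₁ where
  field
    cut     : ℚ → Set
    upward  : ∀ {p q} → p ℚ.≤ q → cut p → cut q
    rounded : ∀ {q} → cut q → ∃[ p ] (p ℚ.< q × cut p)

open ℝ∞ public

infix 4 _≤∞_ _<∞_

_≤∞_ : ℝ∞ → ℝ∞ → Set
r ≤∞ s = ∀ {q} → cut s q → cut r q

_<∞_ : ℝ∞ → ℝ∞ → Set
r <∞ s = ∃[ q ] (cut r q × ¬ cut s q)

private
  <-upward : ∀ x {p q} → p ℚ.≤ q → x < fromℚ p → x < fromℚ q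
  <-upward x p≤q (ε , 0<ε , N , h) = ε , 0<ε , N , λ n N≤n → ℚ.≤-trans (h n N≤n) p≤q

  <-rounded : ∀ x {q} → x < fromℚ q → ∃[ p ] (p ℚ.< q × x < fromℚ p)
  <-rounded x {q} (ε , 0<ε , N , h) =
    q ℚ.- ½ ℚ.* ε ,
    subst (q ℚ.- ½ ℚ.* ε ℚ.<_) (ℚ.+-identityʳ q)
      (ℚ.+-monoʳ-< q (ℚ.neg-antimono-< (0<½* 0<ε))) ,
    ½ ℚ.* ε , 0<½* 0<ε , N , λ n N≤n → begin
      seq x n ℚ.+ ½ ℚ.* ε          ≡⟨ rearrange (seq x n) ε ⟩
      seq x n ℚ.+ ε ℚ.- ½ ℚ.* ε    ≤⟨ ℚ.+-monoˡ-≤ (ℚ.- (½ ℚ.* ε)) (h n N≤n) ⟩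
      q ℚ.- ½ ℚ.* ε                ∎
    where
    open ℚ.≤-Reasoning
    rearrange : ∀ a e → a ℚ.+ ½ ℚ.* e ≡ a ℚ.+ e ℚ.- ½ ℚ.* e
    rearrange = solve 2 (λ a e → a :+ con ½ :* e := a :+ e :- con ½ :* e) refl
      where open +-*-Solver

fromℝ : ℝ → ℝ∞
fromℝ x = record
  { cut     = λ q → x < fromℚ q
  ; upward  = <-upward x
  ; rounded = <-rounded x
  }

inf : (ℝ → Set) → ℝ∞
inf P = record
  { cut     = λ q → ∃[ c ] (P c × c < fromℚ q)
  ; upward  = λ { p≤q (c , Pc , c<p) → c , Pc , <-upward c p≤q c<p }
  ; rounded = λ { (c , Pc , c<q) → let p , p<q , c<p = <-rounded c c<q in p , p<q , c , Pc , c<p }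
  }

inf-lowerBound : ∀ P {c} → P c → inf P ≤∞ fromℝ c
inf-lowerBound P {c} Pc c<q = c , Pc , c<q

inf-greatest : ∀ P {r} → (∀ {c} → P c → r ≤∞ fromℝ c) → r ≤∞ inf P
inf-greatest P lb (c , Pc , c<q) = lb Pc c<q

------------------------------------------------------------------------

record Item : Set where
  field
    weight   : ℝ
    value    : ℝ
    weight>0 : 0ℝ < weight
    weight≤1 : weight ≤ 1ℝ
    value>0  : 0ℝ < value

open Item public

Instance : ℕ → Set
Instance = Vec Item

-- A multiset of items of an instance, as the multiplicity of each
-- position of the instance.
Multiset : ℕ → Set
Multiset = Vec ℕ

total : (Item → ℝ) → ∀ {n} → Instance n → Multiset n → ℝ
total f []      []      = 0ℝ
total f (x ∷ I) (k ∷ S) = fromℕ k * f x + total f I S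

gain : ∀ {n} → Instance n → Multiset n → ℝ
gain = total value

IsSolution : ∀ {n} → Instance n → Multiset n → Set
IsSolution I S = total weight I S ≤ 1ℝ

IsOpt : ∀ {n} → Instance n → Multiset n → Set
IsOpt I S = IsSolution I S × (∀ T → IsSolution I T → gain I T ≤ gain I S)

-- The knapsack is a function of the items received so far, so it depends
-- neither on future items nor on their number.  It starts out empty, as
-- Multiset 0 has no other element.  On arrival of x, some number k of
-- copies of x is added, and then a sub-multiset is removed.
record OnlineAlgorithm : Set where
  field
    knapsack   : ∀ {n} → Instance n → Multiset n
    isSolution : ∀ {n} (I : Instance n) → IsSolution I (knapsack I)
    step       : ∀ {n} (I : Instance n) (x : Item) →
                 ∃[ k ] Pointwise ℕ._≤_ (knapsack (I ∷ʳ x)) (knapsack I ∷ʳ k)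

open OnlineAlgorithm public

Competitive : ℝ → OnlineAlgorithm → Set
Competitive c A = ∀ {n} (I : Instance n) (S : Multiset n) → IsOpt I S →
  gain I S ≤ c * gain I (knapsack A I)

competitiveRatio : OnlineAlgorithm → ℝ∞
competitiveRatio A = inf (λ c → 1ℝ ≤ c × Competitive c A)

------------------------------------------------------------------------
-- sylvester i is the term a_{i+1} of Sylvester's sequence
-- a_1 = 2, a_n = 1 + a_1 ⋯ a_{n-1}; ∏sylvester n is a_1 ⋯ a_n.

sylvester  : ℕ → ℕ
∏sylvester : ℕ → ℕ

sylvester n = 1 ℕ.+ ∏sylvester n

∏sylvester zero    = 1
∏sylvester (suc n) = ∏sylvester n ℕ.* sylvester n

n<∏sylvester : ∀ n → n ℕ.< ∏sylvester n
n<∏sylvester zero    = ℕ.≤-refl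
n<∏sylvester (suc n) = begin-strict
  suc n                           ≤⟨ n<∏sylvester n ⟩
  ∏sylvester n                    <⟨ ℕ.m<m*n (∏sylvester n) (sylvester n) {{ℕ.>-nonZero 0<∏}} (ℕ.s≤s 0<∏) ⟩
  ∏sylvester n ℕ.* sylvester n    ∎
  where
  open ℕ.≤-Reasoning
  0<∏ : 0 ℕ.< ∏sylvester n
  0<∏ = ℕ.≤-trans (ℕ.s≤s ℕ.z≤n) (n<∏sylvester n)

sylvester∸1-nonZero : ∀ n → ℕ.NonZero (sylvester n ℕ.∸ 1)
sylvester∸1-nonZero n = ℕ.>-nonZero (ℕ.≤-trans (ℕ.s≤s ℕ.z≤n) (n<∏sylvester n))

sylvesterTerm : ℕ → ℚ
sylvesterTerm i = (+ 1 / (sylvester i ℕ.∸ 1)) {{sylvester∸1-nonZero i}}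

partialSum : ℕ → ℚ
partialSum zero    = 0ℚ
partialSum (suc n) = partialSum n ℚ.+ sylvesterTerm n

private
  toℚᵘ-/ : ∀ k d .{{_ : ℕ.NonZero d}} → ℚ.toℚᵘ (+ k / d) ℚᵘ.≃ (+ k ℚᵘ./ d)
  toℚᵘ-/ k (suc d) = ℚ.toℚᵘ-fromℚᵘ (ℚᵘ.mkℚᵘ (+ k) d)

  /-≤ : ∀ k d l e .{{_ : ℕ.NonZero d}} .{{_ : ℕ.NonZero e}} →
    k ℕ.* e ℕ.≤ l ℕ.* d → (+ k / d) ℚ.≤ (+ l / e)
  /-≤ k d@(suc _) l e@(suc _) h = ℚ.toℚᵘ-cancel-≤ (begin
    ℚ.toℚᵘ (+ k / d)   ≃⟨ toℚᵘ-/ k d ⟩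
    + k ℚᵘ./ d         ≤⟨ ℚᵘ.*≤* (subst₂ ℤ._≤_ (ℤ.pos-* k e) (ℤ.pos-* l d) (ℤ.+≤+ h)) ⟩
    + l ℚᵘ./ e         ≃⟨ toℚᵘ-/ l e ⟨
    ℚ.toℚᵘ (+ l / e)   ∎)
    where open ℚᵘ.≤-Reasoning

  /-< : ∀ k d l e .{{_ : ℕ.NonZero d}} .{{_ : ℕ.NonZero e}} →
    k ℕ.* e ℕ.< l ℕ.* d → (+ k / d) ℚ.< (+ l / e)
  /-< k d@(suc _) l e@(suc _) h = ℚ.toℚᵘ-cancel-< (begin-strict
    ℚ.toℚᵘ (+ k / d)   ≃⟨ toℚᵘ-/ k d ⟩
    + k ℚᵘ./ d         <⟨ ℚᵘ.*<* (subst₂ ℤ._<_ (ℤ.pos-* k e) (ℤ.pos-* l d) (ℤ.+<+ h)) ⟩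
    + l ℚᵘ./ e         ≃⟨ toℚᵘ-/ l e ⟨
    ℚ.toℚᵘ (+ l / e)   ∎)
    where open ℚᵘ.≤-Reasoning

  1/d+1/d : ∀ d .{{_ : ℕ.NonZero d}} → + 1 / d ℚ.+ + 1 / d ≡ + 2 / d
  1/d+1/d d@(suc _) = ℚ.toℚᵘ-injective (begin-equality
    ℚ.toℚᵘ (+ 1 / d ℚ.+ + 1 / d)                ≃⟨ ℚ.toℚᵘ-homo-+ (+ 1 / d) (+ 1 / d) ⟩
    ℚ.toℚᵘ (+ 1 / d) ℚᵘ.+ ℚ.toℚᵘ (+ 1 / d)      ≃⟨ ℚᵘ.+-cong (toℚᵘ-/ 1 d) (toℚᵘ-/ 1 d) ⟩
    (+ 1 ℚᵘ./ d) ℚᵘ.+ (+ 1 ℚᵘ./ d)              ≃⟨ ℚᵘ.*≡* (ℤ-eq (+ d)) ⟩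
    + 2 ℚᵘ./ d                                  ≃⟨ toℚᵘ-/ 2 d ⟨
    ℚ.toℚᵘ (+ 2 / d)                            ∎)
    where
    open ℚᵘ.≤-Reasoning
    ℤ-eq : ∀ z → (+ 1 ℤ.* z ℤ.+ + 1 ℤ.* z) ℤ.* z ≡ + 2 ℤ.* (z ℤ.* z)
    ℤ-eq = solve 1 (λ z → (con (+ 1) :* z :+ con (+ 1) :* z) :* z := con (+ 2) :* (z :* z)) refl
      where open ℤ-Solver

  tail : ℕ → ℚ
  tail n = (+ 2 / ∏sylvester n) {{sylvester∸1-nonZero n}}

  tail-step : ∀ n → sylvesterTerm n ℚ.+ tail (suc n) ℚ.≤ tail n
  tail-step n = begin
    sylvesterTerm n ℚ.+ tail (suc n)
      ≤⟨ ℚ.+-monoʳ-≤ (sylvesterTerm n)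
           (/-≤ 2 (∏sylvester (suc n)) 1 (∏sylvester n)
              {{sylvester∸1-nonZero (suc n)}} {{sylvester∸1-nonZero n}} 2∏≤∏) ⟩
    sylvesterTerm n ℚ.+ sylvesterTerm n
      ≡⟨ 1/d+1/d (∏sylvester n) {{sylvester∸1-nonZero n}} ⟩
    tail n
      ∎
    where
    open ℚ.≤-Reasoning
    2∏≤∏ : 2 ℕ.* ∏sylvester n ℕ.≤ 1 ℕ.* ∏sylvester (suc n)
    2∏≤∏ = subst₂ ℕ._≤_ (ℕ.*-comm (∏sylvester n) 2) (sym (ℕ.*-identityˡ _))
             (ℕ.*-monoʳ-≤ (∏sylvester n) (ℕ.s≤s (ℕ.≤-trans (ℕ.s≤s ℕ.z≤n) (n<∏sylvester n))))

  0≤term : ∀ n → 0ℚ ℚ.≤ sylvesterTerm n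
  0≤term n = /-≤ 0 1 1 (∏sylvester n) {{_}} {{sylvester∸1-nonZero n}} ℕ.z≤n

  0≤tail : ∀ n → 0ℚ ℚ.≤ tail n
  0≤tail n = /-≤ 0 1 2 (∏sylvester n) {{_}} {{sylvester∸1-nonZero n}} ℕ.z≤n

  partialSum-mono : ∀ {m n} → m ℕ.≤′ n → partialSum m ℚ.≤ partialSum n
  partialSum-mono ℕ.≤′-refl = ℚ.≤-refl
  partialSum-mono {m} {suc n} (ℕ.≤′-step m≤n) = begin
    partialSum m                         ≤⟨ partialSum-mono m≤n ⟩
    partialSum n                         ≡⟨ ℚ.+-identityʳ (partialSum n) ⟨
    partialSum n ℚ.+ 0ℚ                  ≤⟨ ℚ.+-monoʳ-≤ (partialSum n) (0≤term n) ⟩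
    partialSum n ℚ.+ sylvesterTerm n     ∎
    where open ℚ.≤-Reasoning

  upper-anti : ∀ {m n} → m ℕ.≤′ n → partialSum n ℚ.+ tail n ℚ.≤ partialSum m ℚ.+ tail m
  upper-anti ℕ.≤′-refl = ℚ.≤-refl
  upper-anti {m} {suc n} (ℕ.≤′-step m≤n) = begin
    partialSum n ℚ.+ sylvesterTerm n ℚ.+ tail (suc n)      ≡⟨ ℚ.+-assoc (partialSum n) (sylvesterTerm n) (tail (suc n)) ⟩
    partialSum n ℚ.+ (sylvesterTerm n ℚ.+ tail (suc n))    ≤⟨ ℚ.+-monoʳ-≤ (partialSum n) (tail-step n) ⟩
    partialSum n ℚ.+ tail n                                ≤⟨ upper-anti m≤n ⟩
    partialSum m ℚ.+ tail m                                ∎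
    where open ℚ.≤-Reasoning

  partialSum≤ : ∀ {m n} → m ℕ.≤ n → partialSum n ℚ.≤ partialSum m ℚ.+ tail m
  partialSum≤ {m} {n} m≤n = begin
    partialSum n               ≡⟨ ℚ.+-identityʳ (partialSum n) ⟨
    partialSum n ℚ.+ 0ℚ        ≤⟨ ℚ.+-monoʳ-≤ (partialSum n) (0≤tail n) ⟩
    partialSum n ℚ.+ tail n    ≤⟨ upper-anti (ℕ.≤⇒≤′ m≤n) ⟩
    partialSum m ℚ.+ tail m    ∎
    where open ℚ.≤-Reasoning

  -‿≤ : ∀ {l d a b} → l ℚ.≤ b → a ℚ.≤ l ℚ.+ d → a ℚ.- b ℚ.≤ d
  -‿≤ {l} {d} {a} {b} l≤b a≤l+d = begin
    a ℚ.- b              ≤⟨ ℚ.+-mono-≤ a≤l+d (ℚ.neg-antimono-≤ l≤b) ⟩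
    (l ℚ.+ d) ℚ.- l      ≡⟨ cancel l d ⟩
    d                    ∎
    where
    open ℚ.≤-Reasoning
    cancel : ∀ l d → (l ℚ.+ d) ℚ.- l ≡ d
    cancel = solve 2 (λ l d → (l :+ d) :- l := d) refl
      where open +-*-Solver

  ∣-∣≤ : ∀ {l d a b} → l ℚ.≤ a → a ℚ.≤ l ℚ.+ d → l ℚ.≤ b → b ℚ.≤ l ℚ.+ d → ∣ a ℚ.- b ∣ ℚ.≤ d
  ∣-∣≤ {l} {d} {a} {b} l≤a a≤ l≤b b≤ with ℚ.∣p∣≡p∨∣p∣≡-p (a ℚ.- b)
  ... | inj₁ eq = subst (ℚ._≤ d) (sym eq) (-‿≤ l≤b a≤)
  ... | inj₂ eq = subst (ℚ._≤ d) (sym eq) (subst (ℚ._≤ d) (flip a b) (-‿≤ l≤a b≤))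
    where
    flip : ∀ a b → b ℚ.- a ≡ ℚ.- (a ℚ.- b)
    flip = solve 2 (λ a b → b :- a := :- (a :- b)) refl
      where open +-*-Solver

  tail-small : ∀ ε → .{{ℚ.Positive ε}} → ∃[ N ] tail N ℚ.< ε
  tail-small ε@(mkℚ ℤ.+[1+ k ] d-1 _) = N ,
    subst (tail N ℚ.<_) (ℚ.↥p/↧p≡p ε)
      (/-< 2 (∏sylvester N) (suc k) (suc d-1) {{sylvester∸1-nonZero N}}
        (ℕ.<-≤-trans (n<∏sylvester N) (ℕ.m≤m+n (∏sylvester N) (k ℕ.* ∏sylvester N))))
    where
    N : ℕ
    N = 2 ℕ.* suc d-1

  partialSum-cauchy : Cauchy partialSum
  partialSum-cauchy ε 0<ε =
    let N , tail<ε = tail-small ε {{positive 0<ε}}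
    in N , λ m n N≤m N≤n → ℚ.≤-<-trans
      (∣-∣≤ (partialSum-mono (ℕ.≤⇒≤′ N≤m)) (partialSum≤ N≤m)
            (partialSum-mono (ℕ.≤⇒≤′ N≤n)) (partialSum≤ N≤n))
      tail<ε

-- The limit of the partial sums is the real number they represent.
S∞ : ℝ
S∞ = mkℝ partialSum partialSum-cauchy

module Submission where

-- The adversary first offers an item of weight 1 and value B, and then rounds
-- r = 1, 2, … of n light items each, with weights slightly above 1/a₁, …, 1/aₙ
-- and values r d/(a₁ − 1), …, r d/(aₙ − 1).  The light items of a round fit
-- together, with gain r d Sₙ, where Sₙ is the n-th partial sum of S∞.  While the
-- algorithm holds the first item it can hold nothing else, so as soon as it gives
-- that item up it is left with copies of a single light item, of which at most
-- aᵢ − 1 fit: its gain is at most r d, while B and (r − 1) d Sₙ are achievable.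
-- If it never gives the first item up, its gain stays B while r d Sₙ grows
-- without bound.  Against a ratio p < Sₙ, the choice d = Sₙ − p and B = 1 + p Sₙ
-- defeats both behaviours.

open import Data.Empty using (⊥; ⊥-elim)
open import Data.Integer.Base using (+_; -[1+_])
import Data.Integer.Base as ℤ
import Data.Integer.Properties as ℤ
open import Data.List.Base as List using (List; []; _∷_)
open import Data.Nat.Base as ℕ using (ℕ; zero; suc; z≤n; s≤s)
import Data.Nat.Properties as ℕ
open import Data.Product.Base using (∃-syntax; _×_; _,_; proj₁)
open import Data.Rational.Base as ℚ using (ℚ; mkℚ; 0ℚ; 1ℚ; _/_; nonNegative; positive)
import Data.Rational.Properties as ℚ
open import Data.Rational.Solver using (module +-*-Solver)
import Data.Rational.Unnormalised.Base as ℚᵘ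
import Data.Rational.Unnormalised.Properties as ℚᵘ
open import Data.Sum.Base using (_⊎_; inj₁; inj₂; fromInj₁)
open import Data.Vec.Base as Vec using (Vec; []; _∷_; _∷ʳ_; replicate)
open import Data.Vec.Properties using (map-∷ʳ)
open import Data.Vec.Relation.Binary.Pointwise.Inductive using (Pointwise; []; _∷_)
open import Defs
open import Relation.Binary.PropositionalEquality
  using (_≡_; refl; sym; trans; cong; cong₂; subst; subst₂; module ≡-Reasoning)
open import Relation.Nullary using (Dec; yes; no)
open import Relation.Nullary.Negation using (¬_)
open +-*-Solver using (solve; con; _:+_; _:*_; _:-_; _:=_)

-- Naturals inside the rationals, and the Archimedean property.

ι : ℕ → ℚ
ι k = + k / 1

toℚᵘ-ι : ∀ k → ℚ.toℚᵘ (ι k) ℚᵘ.≃ ℚᵘ.mkℚᵘ (+ k) 0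
toℚᵘ-ι k = ℚ.toℚᵘ-fromℚᵘ (ℚᵘ.mkℚᵘ (+ k) 0)

ι-homo-+ : ∀ m n → ι (m ℕ.+ n) ≡ ι m ℚ.+ ι n
ι-homo-+ m n = ℚ.toℚᵘ-injective (begin-equality
  ℚ.toℚᵘ (ι (m ℕ.+ n))                   ≃⟨ toℚᵘ-ι (m ℕ.+ n) ⟩
  ℚᵘ.mkℚᵘ (+ (m ℕ.+ n)) 0                ≃⟨ ℚᵘ.*≡* (cong (ℤ._* + 1) (cong₂ ℤ._+_ (sym (ℤ.*-identityʳ (+ m))) (sym (ℤ.*-identityʳ (+ n))))) ⟩
  ℚᵘ.mkℚᵘ (+ m) 0 ℚᵘ.+ ℚᵘ.mkℚᵘ (+ n) 0   ≃⟨ ℚᵘ.+-cong (toℚᵘ-ι m) (toℚᵘ-ι n) ⟨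
  ℚ.toℚᵘ (ι m) ℚᵘ.+ ℚ.toℚᵘ (ι n)         ≃⟨ ℚ.toℚᵘ-homo-+ (ι m) (ι n) ⟨
  ℚ.toℚᵘ (ι m ℚ.+ ι n)                   ∎)
  where open ℚᵘ.≤-Reasoning

ι-homo-* : ∀ m n → ι (m ℕ.* n) ≡ ι m ℚ.* ι n
ι-homo-* m n = ℚ.toℚᵘ-injective (begin-equality
  ℚ.toℚᵘ (ι (m ℕ.* n))                   ≃⟨ toℚᵘ-ι (m ℕ.* n) ⟩
  ℚᵘ.mkℚᵘ (+ (m ℕ.* n)) 0                ≃⟨ ℚᵘ.*≡* (cong (ℤ._* + 1) (ℤ.pos-* m n)) ⟩
  ℚᵘ.mkℚᵘ (+ m) 0 ℚᵘ.* ℚᵘ.mkℚᵘ (+ n) 0   ≃⟨ ℚᵘ.*-cong (toℚᵘ-ι m) (toℚᵘ-ι n) ⟨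
  ℚ.toℚᵘ (ι m) ℚᵘ.* ℚ.toℚᵘ (ι n)         ≃⟨ ℚ.toℚᵘ-homo-* (ι m) (ι n) ⟨
  ℚ.toℚᵘ (ι m ℚ.* ι n)                   ∎)
  where open ℚᵘ.≤-Reasoning

ι-mono-≤ : ∀ {m n} → m ℕ.≤ n → ι m ℚ.≤ ι n
ι-mono-≤ {m} {n} m≤n = ℚ.toℚᵘ-cancel-≤ (begin
  ℚ.toℚᵘ (ι m)       ≃⟨ toℚᵘ-ι m ⟩
  ℚᵘ.mkℚᵘ (+ m) 0    ≤⟨ ℚᵘ.*≤* (ℤ.*-monoʳ-≤-nonNeg (+ 1) (ℤ.+≤+ m≤n)) ⟩
  ℚᵘ.mkℚᵘ (+ n) 0    ≃⟨ toℚᵘ-ι n ⟨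
  ℚ.toℚᵘ (ι n)       ∎)
  where open ℚᵘ.≤-Reasoning

0≤ι : ∀ k → 0ℚ ℚ.≤ ι k
0≤ι k = ι-mono-≤ {0} {k} z≤n

0<1 : 0ℚ ℚ.< 1ℚ
0<1 = ℚ.positive⁻¹ 1ℚ

0<ι-suc : ∀ k → 0ℚ ℚ.< ι (suc k)
0<ι-suc k = ℚ.<-≤-trans 0<1 (ι-mono-≤ {1} {suc k} (s≤s z≤n))

0≤p*q : ∀ {p q} → 0ℚ ℚ.≤ p → 0ℚ ℚ.≤ q → 0ℚ ℚ.≤ p ℚ.* q
0≤p*q {p} {q} 0≤p 0≤q =
  ℚ.nonNegative⁻¹ _ {{ℚ.nonNeg*nonNeg⇒nonNeg p {{nonNegative 0≤p}} q {{nonNegative 0≤q}}}}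

0<p*q : ∀ {p q} → 0ℚ ℚ.< p → 0ℚ ℚ.< q → 0ℚ ℚ.< p ℚ.* q
0<p*q {p} {q} 0<p 0<q =
  ℚ.positive⁻¹ _ {{ℚ.pos*pos⇒pos p {{positive 0<p}} q {{positive 0<q}}}}

0<q-p : ∀ {p q} → p ℚ.< q → 0ℚ ℚ.< q ℚ.- p
0<q-p {p} {q} p<q = subst (ℚ._< q ℚ.- p) (ℚ.+-inverseʳ p) (ℚ.+-monoˡ-< (ℚ.- p) p<q)

p≤p+q : ∀ p {q} → 0ℚ ℚ.≤ q → p ℚ.≤ p ℚ.+ q
p≤p+q p {q} 0≤q = subst (ℚ._≤ p ℚ.+ q) (ℚ.+-identityʳ p) (ℚ.+-monoʳ-≤ p 0≤q)

*-monoʳ-≤ : ∀ {p q} r → 0ℚ ℚ.≤ r → p ℚ.≤ q → r ℚ.* p ℚ.≤ r ℚ.* q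
*-monoʳ-≤ r 0≤r = ℚ.*-monoˡ-≤-nonNeg r {{nonNegative 0≤r}}

*-monoˡ-≤ : ∀ {p q} r → 0ℚ ℚ.≤ r → p ℚ.≤ q → p ℚ.* r ℚ.≤ q ℚ.* r
*-monoˡ-≤ r 0≤r = ℚ.*-monoʳ-≤-nonNeg r {{nonNegative 0≤r}}

-- Dividing by a denominator of at least 1 cannot increase a nonnegative numerator; a negative `p`
-- lies below any natural number.
≤-ι-numerator : ∀ p → p ℚ.≤ ι ℤ.∣ ℚ.↥ p ∣
≤-ι-numerator p@record{} = ℚ.toℚᵘ-cancel-≤ (ℚᵘ.≤-respʳ-≃ (ℚᵘ.≃-sym (toℚᵘ-ι ℤ.∣ ℚ.↥ p ∣)) (ℚᵘ.*≤* (bound p)))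
  where
  bound : ∀ p → ℚ.↥ p ℤ.* + 1 ℤ.≤ + ℤ.∣ ℚ.↥ p ∣ ℤ.* ℚ.↧ p
  bound (mkℚ (+ k)    d _) = ℤ.*-monoˡ-≤-nonNeg (+ k) (ℤ.+≤+ (s≤s z≤n))
  bound (mkℚ -[1+ k ] d _) = ℤ.-≤+

-- Multiplying by the denominator clears the fraction and leaves the numerator, which is a positive
-- integer.
1≤ι-denominator-* : ∀ q → 0ℚ ℚ.< q → 1ℚ ℚ.≤ ι (ℚ.↧ₙ q) ℚ.* q
1≤ι-denominator-* q 0<q = cleared-≥1 q {{positive 0<q}}
  where
  cleared-≥1 : ∀ q → .{{ℚ.Positive q}} → 1ℚ ℚ.≤ ι (ℚ.↧ₙ q) ℚ.* q
  cleared-≥1 q@(mkℚ ℤ.+[1+ k ] d _) = subst (1ℚ ℚ.≤_) (sym cleared) (ι-mono-≤ {1} {suc k} (s≤s z≤n))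
    where
    open ℚᵘ.≤-Reasoning
    cleared : ι (suc d) ℚ.* q ≡ ι (suc k)
    cleared = ℚ.toℚᵘ-injective (begin-equality
      ℚ.toℚᵘ (ι (suc d) ℚ.* q)                              ≃⟨ ℚ.toℚᵘ-homo-* (ι (suc d)) q ⟩
      ℚ.toℚᵘ (ι (suc d)) ℚᵘ.* ℚᵘ.mkℚᵘ (+ suc k) d           ≃⟨ ℚᵘ.*-congʳ (toℚᵘ-ι (suc d)) ⟩
      ℚᵘ.mkℚᵘ (+ suc d) 0 ℚᵘ.* ℚᵘ.mkℚᵘ (+ suc k) d
        ≃⟨ ℚᵘ.*≡* (trans (ℤ.*-identityʳ (+ suc d ℤ.* + suc k))
             (trans (ℤ.*-comm (+ suc d) (+ suc k)) (cong (λ x → + suc k ℤ.* + x) (sym (ℕ.*-identityˡ (suc d)))))) ⟩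
      ℚᵘ.mkℚᵘ (+ suc k) 0                                   ≃⟨ toℚᵘ-ι (suc k) ⟨
      ℚ.toℚᵘ (ι (suc k))                                    ∎)

archimedean : ∀ p q → 0ℚ ℚ.< q → ∃[ r ] p ℚ.< ι r ℚ.* q
-- The factor `ℚ.↧ₙ q` lifts `q` to at least 1, and `suc m` lies strictly above `p`.
archimedean p q 0<q = suc m ℕ.* ℚ.↧ₙ q , (begin-strict
  p                                  ≤⟨ ≤-ι-numerator p ⟩
  ι m                                ≡⟨ ℚ.+-identityˡ (ι m) ⟨
  0ℚ ℚ.+ ι m                         <⟨ ℚ.+-monoˡ-< (ι m) 0<1 ⟩
  1ℚ ℚ.+ ι m                         ≡⟨ ι-homo-+ 1 m ⟨
  ι (suc m)                          ≡⟨ ℚ.*-identityʳ (ι (suc m)) ⟨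
  ι (suc m) ℚ.* 1ℚ                   ≤⟨ *-monoʳ-≤ (ι (suc m)) (0≤ι (suc m)) (1≤ι-denominator-* q 0<q) ⟩
  ι (suc m) ℚ.* (ι (ℚ.↧ₙ q) ℚ.* q)   ≡⟨ ℚ.*-assoc (ι (suc m)) (ι (ℚ.↧ₙ q)) q ⟨
  ι (suc m) ℚ.* ι (ℚ.↧ₙ q) ℚ.* q     ≡⟨ cong (ℚ._* q) (ι-homo-* (suc m) (ℚ.↧ₙ q)) ⟨
  ι (suc m ℕ.* ℚ.↧ₙ q) ℚ.* q         ∎)
  where
  open ℚ.≤-Reasoning
  m = ℤ.∣ ℚ.↥ p ∣

p+[q-p]≡q : ∀ p q → p ℚ.+ (q ℚ.- p) ≡ q
p+[q-p]≡q = solve 2 (λ p q → p :+ (q :- p) := q) refl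

-- Rational items and their real counterparts.

fromℚ-mono-≤ : ∀ {p q} → p ℚ.≤ q → fromℚ p ≤ fromℚ q
fromℚ-mono-≤ {p} {q} p≤q (ε , 0<ε , N , h) = ℚ.<-irrefl refl (begin-strict
  q          ≡⟨ ℚ.+-identityʳ q ⟨
  q ℚ.+ 0ℚ   <⟨ ℚ.+-monoʳ-< q 0<ε ⟩
  q ℚ.+ ε    ≤⟨ h N ℕ.≤-refl ⟩
  p          ≤⟨ p≤q ⟩
  q          ∎)
  where open ℚ.≤-Reasoning

fromℚ-mono-< : ∀ {p q} → p ℚ.< q → fromℚ p < fromℚ q
fromℚ-mono-< {p} {q} p<q = q ℚ.- p , 0<q-p p<q , 0 , λ _ _ → ℚ.≤-reflexive (p+[q-p]≡q p q)

-- The adversary offers only rational weights and values. Their order is decidable, unlike that of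
-- `ℝ`, so optima can be computed and cases distinguished.
record ℚItem : Set where
  constructor mkItem
  field
    wt   : ℚ
    val  : ℚ
    0<wt  : 0ℚ ℚ.< wt
    wt≤1  : wt ℚ.≤ 1ℚ
    0<val : 0ℚ ℚ.< val

open ℚItem

toItem : ℚItem → Item
toItem x = record
  { weight   = fromℚ (wt x)
  ; value    = fromℚ (val x)
  ; weight>0 = fromℚ-mono-< (0<wt x)
  ; weight≤1 = fromℚ-mono-≤ (wt≤1 x)
  ; value>0  = fromℚ-mono-< (0<val x)
  }

totalℚ : (ℚItem → ℚ) → ∀ {n} → Vec ℚItem n → Multiset n → ℚ
totalℚ f []      []      = 0ℚ
totalℚ f (x ∷ I) (k ∷ S) = ι k ℚ.* f x ℚ.+ totalℚ f I S

-- Sums and products of reals are taken index by index, so totals of constant sequences are again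
-- constant.
seq-total : ∀ (f : Item → ℝ) (g : ℚItem → ℚ) → (∀ x m → seq (f (toItem x)) m ≡ g x) →
  ∀ {n} (I : Vec ℚItem n) S m → seq (total f (Vec.map toItem I) S) m ≡ totalℚ g I S
seq-total f g f≡g []      []      m = refl
seq-total f g f≡g (x ∷ I) (k ∷ S) m =
  cong₂ (λ y t → ι k ℚ.* y ℚ.+ t) (f≡g x m) (seq-total f g f≡g I S m)

seq-weight : ∀ {n} (I : Vec ℚItem n) S m → seq (total weight (Vec.map toItem I) S) m ≡ totalℚ wt I S
seq-weight = seq-total weight wt (λ _ _ → refl)

seq-gain : ∀ {n} (I : Vec ℚItem n) S m → seq (gain (Vec.map toItem I) S) m ≡ totalℚ val I S
seq-gain = seq-total value val (λ _ _ → refl)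

-- The order on `ℝ` is a negated strict inequality; a positive statement about the constants can be
-- recovered because the order of `ℚ` is decidable.
const-≤⇒ : ∀ x y {p q} → (∀ m → seq x m ≡ p) → (∀ m → seq y m ≡ q) → x ≤ y → p ℚ.≤ q
const-≤⇒ x y {p} {q} x≡p y≡q x≤y = ℚ.≮⇒≥ λ q<p →
  let ε , 0<ε , N , h = fromℚ-mono-< q<p
  in x≤y (ε , 0<ε , N , λ n N≤n → begin
       seq y n ℚ.+ ε   ≡⟨ cong (ℚ._+ ε) (y≡q n) ⟩
       q ℚ.+ ε         ≤⟨ h n N≤n ⟩
       p               ≡⟨ x≡p n ⟨
       seq x n         ∎)
  where open ℚ.≤-Reasoning

⇒const-≤ : ∀ x y {p q} → (∀ m → seq x m ≡ p) → (∀ m → seq y m ≡ q) → p ℚ.≤ q → x ≤ y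
⇒const-≤ x y {p} {q} x≡p y≡q p≤q (ε , 0<ε , N , h) = fromℚ-mono-≤ p≤q
  (ε , 0<ε , N , λ n N≤n → begin
    q ℚ.+ ε         ≡⟨ cong (ℚ._+ ε) (y≡q n) ⟨
    seq y n ℚ.+ ε   ≤⟨ h n N≤n ⟩
    seq x n         ≡⟨ x≡p n ⟩
    p               ∎)
  where open ℚ.≤-Reasoning

0≤totalℚ : ∀ f → (∀ x → 0ℚ ℚ.≤ f x) → ∀ {n} (I : Vec ℚItem n) S → 0ℚ ℚ.≤ totalℚ f I S
0≤totalℚ f 0≤f []      []      = ℚ.≤-refl
0≤totalℚ f 0≤f (x ∷ I) (k ∷ S) =
  ℚ.+-mono-≤ (0≤p*q (0≤ι k) (0≤f x)) (0≤totalℚ f 0≤f I S)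

0≤wt : ∀ x → 0ℚ ℚ.≤ wt x
0≤wt x = ℚ.<⇒≤ (0<wt x)

0≤val : ∀ x → 0ℚ ℚ.≤ val x
0≤val x = ℚ.<⇒≤ (0<val x)

+≤⇒≤- : ∀ p q {r} → p ℚ.+ q ℚ.≤ r → q ℚ.≤ r ℚ.- p
+≤⇒≤- p q {r} h = subst (ℚ._≤ r ℚ.- p) (cancel p q) (ℚ.+-monoˡ-≤ (ℚ.- p) h)
  where
  cancel : ∀ p q → p ℚ.+ q ℚ.- p ≡ q
  cancel = solve 2 (λ p q → p :+ q :- p := q) refl

≤-⇒+≤ : ∀ p {q} r → q ℚ.≤ r ℚ.- p → p ℚ.+ q ℚ.≤ r
≤-⇒+≤ p {q} r h = subst (p ℚ.+ q ℚ.≤_) (p+[q-p]≡q p r) (ℚ.+-monoʳ-≤ p h)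

-- Existence of optima, and competitiveness in rational terms.

-- `Competitive` speaks only about optimal solutions, so one has to be exhibited before it yields
-- anything. The capacity `b` varies because fixing the copies of the head item leaves a smaller one
-- to the other items.
Optimum : ∀ {n} → Vec ℚItem n → ℚ → Set
Optimum I b = ∃[ S ] (totalℚ wt I S ℚ.≤ b ×
  (∀ T → totalℚ wt I T ℚ.≤ b → totalℚ val I T ℚ.≤ totalℚ val I S))

OptimumUpTo : ∀ {n} → ℕ → Vec ℚItem (suc n) → ℚ → Set
OptimumUpTo M I b = ∃[ S ] (totalℚ wt I S ℚ.≤ b ×
  (∀ k T → k ℕ.≤ M → totalℚ wt I (k ∷ T) ℚ.≤ b → totalℚ val I (k ∷ T) ℚ.≤ totalℚ val I S))

≤-suc-elim : ∀ {A : Set} {M} {P : ℕ → A → Set} →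
  (∀ k a → k ℕ.≤ M → P k a) → (∀ a → P (suc M) a) → ∀ k a → k ℕ.≤ suc M → P k a
≤-suc-elim below top k a k≤1+M with ℕ.m≤n⇒m<n∨m≡n k≤1+M
... | inj₁ (s≤s k≤M) = below k a k≤M
... | inj₂ refl      = top a

-- Induction on the cap `M`: the best solution with at most `M` copies of `x` competes with `suc M`
-- copies completed by an optimum for the remaining capacity, if that many copies fit.
optimumUpTo : ∀ {n} x (I : Vec ℚItem n) → (∀ b → 0ℚ ℚ.≤ b → Optimum I b) →
  ∀ M b → 0ℚ ℚ.≤ b → OptimumUpTo M (x ∷ I) b
optimumUpTo x I opt zero b 0≤b =
  let S , S≤b , best = opt b 0≤b
  in 0 ∷ S , subst (ℚ._≤ b) (sym (drop wt S)) S≤b ,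
     λ { zero T z≤n T≤b → ℚ.+-monoʳ-≤ (0ℚ ℚ.* val x) (best T (subst (ℚ._≤ b) (drop wt T) T≤b)) }
  where
  drop : ∀ f S → totalℚ f (x ∷ I) (0 ∷ S) ≡ totalℚ f I S
  drop f S = trans (cong (ℚ._+ totalℚ f I S) (ℚ.*-zeroˡ (f x))) (ℚ.+-identityˡ (totalℚ f I S))
optimumUpTo {n} x I opt (suc M) b 0≤b =
  extend (optimumUpTo x I opt M b 0≤b) (ι (suc M) ℚ.* wt x ℚ.≤? b)
  where
  w v : ℚ
  w = ι (suc M) ℚ.* wt x
  v = ι (suc M) ℚ.* val x

  better : OptimumUpTo M (x ∷ I) b → (o : Optimum I (b ℚ.- w)) → OptimumUpTo (suc M) (x ∷ I) b
  better (S , S≤b , best) (S′ , S′≤b-w , best′) =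
    choose (ℚ.≤-total (totalℚ val (x ∷ I) S) (v ℚ.+ totalℚ val I S′))
    where
    best-top : ∀ T → w ℚ.+ totalℚ wt I T ℚ.≤ b → v ℚ.+ totalℚ val I T ℚ.≤ v ℚ.+ totalℚ val I S′
    best-top T T≤b = ℚ.+-monoʳ-≤ v (best′ T (+≤⇒≤- w (totalℚ wt I T) T≤b))
    choose : totalℚ val (x ∷ I) S ℚ.≤ v ℚ.+ totalℚ val I S′ ⊎ v ℚ.+ totalℚ val I S′ ℚ.≤ totalℚ val (x ∷ I) S →
      OptimumUpTo (suc M) (x ∷ I) b
    choose (inj₁ S≤S′) = suc M ∷ S′ , ≤-⇒+≤ w b S′≤b-w ,
      ≤-suc-elim (λ k T k≤M T≤b → ℚ.≤-trans (best k T k≤M T≤b) S≤S′) best-top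
    choose (inj₂ S′≤S) = S , S≤b ,
      ≤-suc-elim best (λ T T≤b → ℚ.≤-trans (best-top T T≤b) S′≤S)

  extend : OptimumUpTo M (x ∷ I) b → Dec (w ℚ.≤ b) → OptimumUpTo (suc M) (x ∷ I) b
  extend (S , S≤b , best) (no w≰b) = S , S≤b , ≤-suc-elim best
    (λ T T≤b → ⊥-elim (w≰b (ℚ.≤-trans (p≤p+q w (0≤totalℚ wt 0≤wt I T)) T≤b)))
  extend o (yes w≤b) =
    better o (opt (b ℚ.- w) (+≤⇒≤- w 0ℚ (subst (ℚ._≤ b) (sym (ℚ.+-identityʳ w)) w≤b)))

optimum : ∀ {n} (I : Vec ℚItem n) b → 0ℚ ℚ.≤ b → Optimum I b
optimum []      b 0≤b = [] , 0≤b , λ { [] _ → ℚ.≤-refl }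
-- The weight of `x` is positive, so some `M` bounds its multiplicity in every solution, and the
-- capped search is exhaustive.
optimum (x ∷ I) b 0≤b = bounded (archimedean b (wt x) (0<wt x))
  where
  bounded : ∃[ M ] b ℚ.< ι M ℚ.* wt x → Optimum (x ∷ I) b
  bounded (M , b<Mx) =
    let S , S≤b , best = optimumUpTo x I (optimum I) M b 0≤b
    in S , S≤b , λ { (k ∷ T) T≤b → best k T (k≤M k T T≤b) T≤b }
    where
    k≤M : ∀ k T → totalℚ wt (x ∷ I) (k ∷ T) ℚ.≤ b → k ℕ.≤ M
    k≤M k T T≤b = ℕ.≮⇒≥ λ M<k → ℚ.<-irrefl refl (begin-strict
      b                               <⟨ b<Mx ⟩
      ι M ℚ.* wt x                    ≤⟨ *-monoˡ-≤ (wt x) (0≤wt x) (ι-mono-≤ (ℕ.<⇒≤ M<k)) ⟩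
      ι k ℚ.* wt x                    ≤⟨ p≤p+q (ι k ℚ.* wt x) (0≤totalℚ wt 0≤wt I T) ⟩
      totalℚ wt (x ∷ I) (k ∷ T)       ≤⟨ T≤b ⟩
      b                               ∎)
      where open ℚ.≤-Reasoning

optimum⇒IsOpt : ∀ {n} (I : Vec ℚItem n) → (o : Optimum I 1ℚ) → IsOpt (Vec.map toItem I) (proj₁ o)
optimum⇒IsOpt I (S , S≤1 , best) =
  ⇒const-≤ (total weight (Vec.map toItem I) S) 1ℝ (seq-weight I S) (λ _ → refl) S≤1 ,
  λ T T≤1 → ⇒const-≤ (gain (Vec.map toItem I) T) (gain (Vec.map toItem I) S) (seq-gain I T) (seq-gain I S)
    (best T (const-≤⇒ (total weight (Vec.map toItem I) T) 1ℝ (seq-weight I T) (λ _ → refl) T≤1))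

-- Replaces the real ratio by a rational above it and the optimum by any solution `T`, which the
-- optimum dominates.
competitiveℚ : ∀ {c p A} → Competitive c A → c < fromℚ p → ∀ {n} (I : Vec ℚItem n) T →
  totalℚ wt I T ℚ.≤ 1ℚ → totalℚ val I T ℚ.≤ p ℚ.* totalℚ val I (knapsack A (Vec.map toItem I))
competitiveℚ {c} {p} {A} comp (ε , 0<ε , N , h) I T T≤1 = against (optimum I 1ℚ (ℚ.<⇒≤ 0<1))
  where
  open ℚ.≤-Reasoning
  J = Vec.map toItem I
  g = totalℚ val I (knapsack A J)
  0≤g : 0ℚ ℚ.≤ g
  0≤g = 0≤totalℚ val 0≤val I (knapsack A J)
  against : Optimum I 1ℚ → totalℚ val I T ℚ.≤ p ℚ.* g
  -- If the optimum exceeded `p ℚ.* g`, the excess would be a uniform gap witnessing that `c` times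
  -- the gain of the algorithm is below the optimum. Nonnegativity of `g` lets `c` be replaced by
  -- `p`.
  against o@(S , _ , best) = ℚ.≤-trans (best T T≤1) (ℚ.≮⇒≥ λ pg<S → comp J S (optimum⇒IsOpt I o)
    (totalℚ val I S ℚ.- p ℚ.* g , 0<q-p pg<S , N , λ n N≤n → begin
      seq c n ℚ.* seq (gain J (knapsack A J)) n ℚ.+ (totalℚ val I S ℚ.- p ℚ.* g)
        ≡⟨ cong (λ z → seq c n ℚ.* z ℚ.+ (totalℚ val I S ℚ.- p ℚ.* g)) (seq-gain I (knapsack A J) n) ⟩
      seq c n ℚ.* g ℚ.+ (totalℚ val I S ℚ.- p ℚ.* g)
        ≤⟨ ℚ.+-monoˡ-≤ (totalℚ val I S ℚ.- p ℚ.* g)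
             (*-monoˡ-≤ g 0≤g (ℚ.≤-trans (p≤p+q (seq c n) (ℚ.<⇒≤ 0<ε)) (h n N≤n))) ⟩
      p ℚ.* g ℚ.+ (totalℚ val I S ℚ.- p ℚ.* g)
        ≡⟨ p+[q-p]≡q (p ℚ.* g) (totalℚ val I S) ⟩
      totalℚ val I S
        ≡⟨ seq-gain I S n ⟨
      seq (gain J S) n ∎))

-- Multisets over a growing sequence of arrivals.

totalℚ-∷ʳ : ∀ f {n} (I : Vec ℚItem n) x S k → totalℚ f (I ∷ʳ x) (S ∷ʳ k) ≡ totalℚ f I S ℚ.+ ι k ℚ.* f x
totalℚ-∷ʳ f []      x []      k = ℚ.+-comm (ι k ℚ.* f x) 0ℚ
totalℚ-∷ʳ f (y ∷ I) x (j ∷ S) k = trans (cong (ι j ℚ.* f y ℚ.+_) (totalℚ-∷ʳ f I x S k))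
  (sym (ℚ.+-assoc (ι j ℚ.* f y) (totalℚ f I S) (ι k ℚ.* f x)))

totalℚ-zeros : ∀ f {n} (I : Vec ℚItem n) → totalℚ f I (replicate n 0) ≡ 0ℚ
totalℚ-zeros f []      = refl
totalℚ-zeros f (x ∷ I) = cong₂ ℚ._+_ (ℚ.*-zeroˡ (f x)) (totalℚ-zeros f I)

replicate-∷ʳ : ∀ n → replicate n 0 ∷ʳ 0 ≡ replicate (suc n) 0
replicate-∷ʳ zero    = refl
replicate-∷ʳ (suc n) = cong (0 ∷_) (replicate-∷ʳ n)

≤-zeros-∷ʳ : ∀ n {k S} → Pointwise ℕ._≤_ S (replicate n 0 ∷ʳ k) → ∃[ j ] S ≡ replicate n 0 ∷ʳ j
≤-zeros-∷ʳ zero    {S = j ∷ []} (_ ∷ [])  = j , refl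
≤-zeros-∷ʳ (suc n) {S = _ ∷ _}  (z≤n ∷ h) = let j , eq = ≤-zeros-∷ʳ n h in j , cong (0 ∷_) eq

knapsackℚ : OnlineAlgorithm → ∀ {n} → Vec ℚItem n → Multiset n
knapsackℚ A I = knapsack A (Vec.map toItem I)

knapsackℚ-weight : ∀ A {n} (I : Vec ℚItem n) → totalℚ wt I (knapsackℚ A I) ℚ.≤ 1ℚ
knapsackℚ-weight A I = const-≤⇒ (total weight (Vec.map toItem I) (knapsackℚ A I)) 1ℝ
  (seq-weight I (knapsackℚ A I)) (λ _ → refl) (isSolution A (Vec.map toItem I))

knapsackℚ-step : ∀ A {n} (I : Vec ℚItem n) x →
  ∃[ k ] Pointwise ℕ._≤_ (knapsackℚ A (I ∷ʳ x)) (knapsackℚ A I ∷ʳ k)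
knapsackℚ-step A I x = subst
  (λ J → ∃[ k ] Pointwise ℕ._≤_ (knapsack A J) (knapsackℚ A I ∷ʳ k))
  (sym (map-∷ʳ toItem x I)) (step A (Vec.map toItem I) (toItem x))

-- The list of later arrivals has the most recent one at its head.
arrivals : ℚItem → (L : List ℚItem) → Vec ℚItem (suc (List.length L))
arrivals X []      = X ∷ []
arrivals X (x ∷ L) = arrivals X L ∷ʳ x

-- Weight and gain are indices, so that both can be rewritten along equations while the multiset
-- stays anonymous.
Packing : ℚItem → List ℚItem → ℚ → ℚ → Set
Packing X L w g = ∃[ T ] (totalℚ wt (arrivals X L) T ≡ w × totalℚ val (arrivals X L) T ≡ g)

empty-packing : ∀ X L → Packing X L 0ℚ 0ℚ
empty-packing X L = replicate _ 0 , totalℚ-zeros wt (arrivals X L) , totalℚ-zeros val (arrivals X L)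

extend-packing : ∀ k X L {w g} x → Packing X L w g → Packing X (x ∷ L) (w ℚ.+ ι k ℚ.* wt x) (g ℚ.+ ι k ℚ.* val x)
extend-packing k X L x (T , w≡ , g≡) = T ∷ʳ k ,
  trans (totalℚ-∷ʳ wt (arrivals X L) x T k) (cong (ℚ._+ ι k ℚ.* wt x) w≡) ,
  trans (totalℚ-∷ʳ val (arrivals X L) x T k) (cong (ℚ._+ ι k ℚ.* val x) g≡)

skip : ∀ X L {w g} x → Packing X L w g → Packing X (x ∷ L) w g
skip X L {w} {g} x P = subst₂ (Packing X (x ∷ L)) (drop w (wt x)) (drop g (val x)) (extend-packing 0 X L x P)
  where
  drop : ∀ p q → p ℚ.+ 0ℚ ℚ.* q ≡ p
  drop = solve 2 (λ p q → p :+ con 0ℚ :* q := p) refl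

take : ∀ X L {w g} x → Packing X L w g → Packing X (x ∷ L) (w ℚ.+ wt x) (g ℚ.+ val x)
take X L {w} {g} x P = subst₂ (Packing X (x ∷ L)) (cong (w ℚ.+_) (ℚ.*-identityˡ (wt x)))
  (cong (g ℚ.+_) (ℚ.*-identityˡ (val x))) (extend-packing 1 X L x P)

totalℚ-first : ∀ f X L → totalℚ f (arrivals X L) (1 ∷ replicate (List.length L) 0) ≡ f X
totalℚ-first f X []      = trans (ℚ.+-identityʳ (1ℚ ℚ.* f X)) (ℚ.*-identityˡ (f X))
totalℚ-first f X (x ∷ L) = begin
  totalℚ f (arrivals X L ∷ʳ x) (1 ∷ replicate (suc l) 0)          ≡⟨ cong (λ S → totalℚ f (arrivals X L ∷ʳ x) (1 ∷ S)) (replicate-∷ʳ l) ⟨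
  totalℚ f (arrivals X L ∷ʳ x) ((1 ∷ replicate l 0) ∷ʳ 0)         ≡⟨ totalℚ-∷ʳ f (arrivals X L) x (1 ∷ replicate l 0) 0 ⟩
  totalℚ f (arrivals X L) (1 ∷ replicate l 0) ℚ.+ 0ℚ ℚ.* f x      ≡⟨ cong₂ ℚ._+_ (totalℚ-first f X L) (ℚ.*-zeroˡ (f x)) ⟩
  f X ℚ.+ 0ℚ                                                      ≡⟨ ℚ.+-identityʳ (f X) ⟩
  f X                                                             ∎
  where
  open ≡-Reasoning
  l = List.length L

first-packing : ∀ X L → Packing X L (wt X) (val X)
first-packing X L = 1 ∷ replicate _ 0 , totalℚ-first wt X L , totalℚ-first val X L

-- Keeping or giving up the first item.

HoldsFirst : OnlineAlgorithm → ℚItem → List ℚItem → Set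
HoldsFirst A X L = knapsackℚ A (arrivals X L) ≡ 1 ∷ replicate (List.length L) 0

-- The case `j` = 0 covers discarding the first item without taking the new one.
HoldsCopies : OnlineAlgorithm → ℚItem → List ℚItem → ℚItem → Set
HoldsCopies A X L x = ∃[ j ] (ι j ℚ.* wt x ℚ.≤ 1ℚ ×
  totalℚ val (arrivals X (x ∷ L)) (knapsackℚ A (arrivals X (x ∷ L))) ≡ ι j ℚ.* val x)

-- The first item fills the knapsack, so keeping it excludes `x`; once it is removed, no earlier
-- item can be restored and only copies of `x` remain.
hold-or-switch : ∀ A X L x → wt X ≡ 1ℚ → HoldsFirst A X L → HoldsFirst A X (x ∷ L) ⊎ HoldsCopies A X L x
hold-or-switch A X L x wtX≡1 holds =
  let k , h = knapsackℚ-step A (arrivals X L) x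
  in analyse (subst (λ S → Pointwise ℕ._≤_ K (S ∷ʳ k)) holds h) (knapsackℚ-weight A (arrivals X (x ∷ L)))
  where
  l = List.length L
  K = knapsackℚ A (arrivals X (x ∷ L))

  analyse : ∀ {k S} → Pointwise ℕ._≤_ S (1 ∷ (replicate l 0 ∷ʳ k)) →
    totalℚ wt (arrivals X (x ∷ L)) S ℚ.≤ 1ℚ →
    S ≡ 1 ∷ replicate (suc l) 0 ⊎
    ∃[ j ] (ι j ℚ.* wt x ℚ.≤ 1ℚ × totalℚ val (arrivals X (x ∷ L)) S ≡ ι j ℚ.* val x)
  -- The items between `X` and `x` had multiplicity 0, which removal cannot raise; only the
  -- multiplicities `i` and `j` at the two ends are open.
  analyse {S = i ∷ S} (i≤1 ∷ h) S≤1 with j , refl ← ≤-zeros-∷ʳ l h = cases i j i≤1 S≤1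
    where
    cases : ∀ i j → i ℕ.≤ 1 → totalℚ wt (arrivals X (x ∷ L)) (i ∷ (replicate l 0 ∷ʳ j)) ℚ.≤ 1ℚ →
      i ∷ (replicate l 0 ∷ʳ j) ≡ 1 ∷ replicate (suc l) 0 ⊎
      ∃[ j′ ] (ι j′ ℚ.* wt x ℚ.≤ 1ℚ ×
        totalℚ val (arrivals X (x ∷ L)) (i ∷ (replicate l 0 ∷ʳ j)) ≡ ι j′ ℚ.* val x)
    cases 0 j _ ≤1 = inj₂ (j , subst (ℚ._≤ 1ℚ) (only wt) ≤1 , only val)
      where
      only : ∀ f → totalℚ f (arrivals X (x ∷ L)) ((0 ∷ replicate l 0) ∷ʳ j) ≡ ι j ℚ.* f x
      only f = trans (totalℚ-∷ʳ f (arrivals X L) x (replicate (suc l) 0) j)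
        (trans (cong (ℚ._+ ι j ℚ.* f x) (totalℚ-zeros f (arrivals X L))) (ℚ.+-identityˡ (ι j ℚ.* f x)))
    cases 1 0       _ ≤1 = inj₁ (cong (1 ∷_) (replicate-∷ʳ l))
    cases 1 (suc j) _ ≤1 = ⊥-elim (ℚ.<-irrefl refl (begin-strict
      1ℚ                                                                    ≡⟨ ℚ.+-identityʳ 1ℚ ⟨
      1ℚ ℚ.+ 0ℚ                                                             <⟨ ℚ.+-monoʳ-< 1ℚ (0<p*q (0<ι-suc j) (0<wt x)) ⟩
      1ℚ ℚ.+ ι (suc j) ℚ.* wt x                                             ≡⟨ cong (ℚ._+ ι (suc j) ℚ.* wt x) (trans (totalℚ-first wt X L) wtX≡1) ⟨
      totalℚ wt (arrivals X L) (1 ∷ replicate l 0) ℚ.+ ι (suc j) ℚ.* wt x   ≡⟨ totalℚ-∷ʳ wt (arrivals X L) x (1 ∷ replicate l 0) (suc j) ⟨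
      totalℚ wt (arrivals X (x ∷ L)) ((1 ∷ replicate l 0) ∷ʳ suc j)         ≤⟨ ≤1 ⟩
      1ℚ                                                                    ∎))
      where open ℚ.≤-Reasoning
    cases (suc (suc _)) _ (s≤s ()) _

-- Sylvester reciprocals and the weights of the light items.

ι*1/ : ∀ d .{{_ : ℕ.NonZero d}} → ι d ℚ.* (+ 1 / d) ≡ 1ℚ
ι*1/ d@(suc d-1) = ℚ.toℚᵘ-injective (begin-equality
  ℚ.toℚᵘ (ι d ℚ.* (+ 1 / d))                     ≃⟨ ℚ.toℚᵘ-homo-* (ι d) (+ 1 / d) ⟩
  ℚ.toℚᵘ (ι d) ℚᵘ.* ℚ.toℚᵘ (+ 1 / d)             ≃⟨ ℚᵘ.*-cong (toℚᵘ-ι d) (ℚ.toℚᵘ-fromℚᵘ (ℚᵘ.mkℚᵘ (+ 1) d-1)) ⟩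
  ℚᵘ.mkℚᵘ (+ d) 0 ℚᵘ.* ℚᵘ.mkℚᵘ (+ 1) d-1         ≃⟨ ℚᵘ.*≡* (ℤ-eq (+ d)) ⟩
  ℚᵘ.mkℚᵘ (+ 1) 0                                ≃⟨ toℚᵘ-ι 1 ⟨
  ℚ.toℚᵘ 1ℚ                                      ∎)
  where
  open ℚᵘ.≤-Reasoning
  ℤ-eq : ∀ z → z ℤ.* + 1 ℤ.* + 1 ≡ + 1 ℤ.* (+ 1 ℤ.* z)
  ℤ-eq z = trans (ℤ.*-identityʳ (z ℤ.* + 1)) (trans (ℤ.*-identityʳ z)
    (sym (trans (ℤ.*-identityˡ (+ 1 ℤ.* z)) (ℤ.*-identityˡ z))))

∏*term : ∀ i → ι (∏sylvester i) ℚ.* sylvesterTerm i ≡ 1ℚ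
∏*term i = ι*1/ (∏sylvester i) {{sylvester∸1-nonZero i}}

-- 1/aᵢ₊₁ in a form that telescopes.
recip : ℕ → ℚ
recip i = sylvesterTerm i ℚ.- sylvesterTerm (suc i)

-- With `P` = aᵢ₊₁ - 1, the two terms are 1/P and 1/(P(1 + P)), whose difference is 1/(1 + P). The
-- calculation avoids division and uses only the product identities of both terms.
sylvester*recip : ∀ i → ι (sylvester i) ℚ.* recip i ≡ 1ℚ
sylvester*recip i = begin
  ι (sylvester i) ℚ.* (u ℚ.- u′)                          ≡⟨ cong (ℚ._* (u ℚ.- u′)) (ι-homo-+ 1 (∏sylvester i)) ⟩
  (1ℚ ℚ.+ P) ℚ.* (u ℚ.- u′)                               ≡⟨ expand P u u′ ⟩
  -- Writing the factor 1 as `P ℚ.* u` supplies the `P` that `next` needs beside `u′`.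
  u ℚ.+ P ℚ.* u ℚ.- 1ℚ ℚ.* ((1ℚ ℚ.+ P) ℚ.* u′)            ≡⟨ cong (λ z → u ℚ.+ P ℚ.* u ℚ.- z ℚ.* ((1ℚ ℚ.+ P) ℚ.* u′)) (∏*term i) ⟨
  u ℚ.+ P ℚ.* u ℚ.- P ℚ.* u ℚ.* ((1ℚ ℚ.+ P) ℚ.* u′)       ≡⟨ regroup P u u′ ⟩
  u ℚ.+ P ℚ.* u ℚ.- u ℚ.* (P ℚ.* (1ℚ ℚ.+ P) ℚ.* u′)       ≡⟨ cong₂ (λ y z → u ℚ.+ y ℚ.- u ℚ.* z) (∏*term i) next ⟩
  u ℚ.+ 1ℚ ℚ.- u ℚ.* 1ℚ                                   ≡⟨ collapse u ⟩
  1ℚ                                                      ∎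
  where
  open ≡-Reasoning
  P = ι (∏sylvester i)
  u = sylvesterTerm i
  u′ = sylvesterTerm (suc i)
  next : P ℚ.* (1ℚ ℚ.+ P) ℚ.* u′ ≡ 1ℚ
  next = begin
    P ℚ.* (1ℚ ℚ.+ P) ℚ.* u′           ≡⟨ cong (λ a → P ℚ.* a ℚ.* u′) (ι-homo-+ 1 (∏sylvester i)) ⟨
    P ℚ.* ι (sylvester i) ℚ.* u′      ≡⟨ cong (ℚ._* u′) (ι-homo-* (∏sylvester i) (sylvester i)) ⟨
    ι (∏sylvester (suc i)) ℚ.* u′     ≡⟨ ∏*term (suc i) ⟩
    1ℚ                                ∎
  expand : ∀ P u u′ → (1ℚ ℚ.+ P) ℚ.* (u ℚ.- u′) ≡ u ℚ.+ P ℚ.* u ℚ.- 1ℚ ℚ.* ((1ℚ ℚ.+ P) ℚ.* u′)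
  expand = solve 3 (λ P u u′ → (con 1ℚ :+ P) :* (u :- u′) := u :+ P :* u :- con 1ℚ :* ((con 1ℚ :+ P) :* u′)) refl
  regroup : ∀ P u u′ → u ℚ.+ P ℚ.* u ℚ.- P ℚ.* u ℚ.* ((1ℚ ℚ.+ P) ℚ.* u′) ≡ u ℚ.+ P ℚ.* u ℚ.- u ℚ.* (P ℚ.* (1ℚ ℚ.+ P) ℚ.* u′)
  regroup = solve 3 (λ P u u′ → u :+ P :* u :- P :* u :* ((con 1ℚ :+ P) :* u′) := u :+ P :* u :- u :* (P :* (con 1ℚ :+ P) :* u′)) refl
  collapse : ∀ u → u ℚ.+ 1ℚ ℚ.- u ℚ.* 1ℚ ≡ 1ℚ
  collapse = solve 1 (λ u → u :+ con 1ℚ :- u :* con 1ℚ := con 1ℚ) refl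

-- This is (1 + 1/(aₙ₊₁ − 1))/aᵢ₊₁; the first n of these sum to 1 − 1/(aₙ₊₁ − 1)².
lightWeight : ℕ → ℕ → ℚ
lightWeight n i = recip i ℚ.* (1ℚ ℚ.+ sylvesterTerm n)

sylvester*lightWeight : ∀ n i → ι (sylvester i) ℚ.* lightWeight n i ≡ 1ℚ ℚ.+ sylvesterTerm n
sylvester*lightWeight n i = begin
  ι (sylvester i) ℚ.* (recip i ℚ.* (1ℚ ℚ.+ sylvesterTerm n))   ≡⟨ ℚ.*-assoc (ι (sylvester i)) (recip i) (1ℚ ℚ.+ sylvesterTerm n) ⟨
  ι (sylvester i) ℚ.* recip i ℚ.* (1ℚ ℚ.+ sylvesterTerm n)     ≡⟨ cong (ℚ._* (1ℚ ℚ.+ sylvesterTerm n)) (sylvester*recip i) ⟩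
  1ℚ ℚ.* (1ℚ ℚ.+ sylvesterTerm n)                              ≡⟨ ℚ.*-identityˡ (1ℚ ℚ.+ sylvesterTerm n) ⟩
  1ℚ ℚ.+ sylvesterTerm n                                       ∎
  where open ≡-Reasoning

0<∏sylvester : ∀ i → 0 ℕ.< ∏sylvester i
0<∏sylvester i = ℕ.≤-<-trans z≤n (n<∏sylvester i)

-- Reads a sign off a product identity. The sign of `lightWeight` is not visible otherwise, since
-- `recip` is a difference.
0<-cancel : ∀ k {q r} → ι k ℚ.* q ≡ r → 0ℚ ℚ.< r → 0ℚ ℚ.< q
0<-cancel k {q} {r} kq≡r 0<r = ℚ.*-cancelˡ-<-nonNeg (ι k) {{nonNegative (0≤ι k)}} (begin-strict
  ι k ℚ.* 0ℚ   ≡⟨ ℚ.*-zeroʳ (ι k) ⟩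
  0ℚ           <⟨ 0<r ⟩
  r            ≡⟨ kq≡r ⟨
  ι k ℚ.* q    ∎)
  where open ℚ.≤-Reasoning

0<term : ∀ i → 0ℚ ℚ.< sylvesterTerm i
0<term i = 0<-cancel (∏sylvester i) (∏*term i) 0<1

term≤1 : ∀ i → sylvesterTerm i ℚ.≤ 1ℚ
term≤1 i = begin
  sylvesterTerm i                            ≡⟨ ℚ.*-identityˡ (sylvesterTerm i) ⟨
  ι 1 ℚ.* sylvesterTerm i                    ≤⟨ *-monoˡ-≤ (sylvesterTerm i) (ℚ.<⇒≤ (0<term i)) (ι-mono-≤ (0<∏sylvester i)) ⟩
  ι (∏sylvester i) ℚ.* sylvesterTerm i       ≡⟨ ∏*term i ⟩
  1ℚ                                         ∎
  where open ℚ.≤-Reasoning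

0<1+term : ∀ n → 0ℚ ℚ.< 1ℚ ℚ.+ sylvesterTerm n
0<1+term n = ℚ.<-≤-trans 0<1 (p≤p+q 1ℚ (ℚ.<⇒≤ (0<term n)))

0<lightWeight : ∀ n i → 0ℚ ℚ.< lightWeight n i
0<lightWeight n i = 0<-cancel (sylvester i) (sylvester*lightWeight n i) (0<1+term n)

-- As aᵢ₊₁ is at least 2, twice the weight is at most 1 + 1/(aₙ₊₁ - 1), hence at most 2.
lightWeight≤1 : ∀ n i → lightWeight n i ℚ.≤ 1ℚ
lightWeight≤1 n i = ℚ.*-cancelˡ-≤-pos (ι 2) (begin
  ι 2 ℚ.* lightWeight n i                ≤⟨ *-monoˡ-≤ (lightWeight n i) (ℚ.<⇒≤ (0<lightWeight n i)) (ι-mono-≤ (s≤s (0<∏sylvester i))) ⟩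
  ι (sylvester i) ℚ.* lightWeight n i    ≡⟨ sylvester*lightWeight n i ⟩
  1ℚ ℚ.+ sylvesterTerm n                 ≤⟨ ℚ.+-monoʳ-≤ 1ℚ (term≤1 n) ⟩
  ι 2 ℚ.* 1ℚ                             ∎)
  where open ℚ.≤-Reasoning

-- Already aᵢ₊₁ copies weigh 1 + 1/(aₙ₊₁ - 1), too much, so at most aᵢ₊₁ - 1 fit, each contributing
-- 1/(aᵢ₊₁ - 1).
copies-worth≤1 : ∀ n i k → ι k ℚ.* lightWeight n i ℚ.≤ 1ℚ → ι k ℚ.* sylvesterTerm i ℚ.≤ 1ℚ
copies-worth≤1 n i k fits = begin
  ι k ℚ.* sylvesterTerm i                ≤⟨ *-monoˡ-≤ (sylvesterTerm i) (ℚ.<⇒≤ (0<term i)) (ι-mono-≤ (ℕ.≮⇒≥ ∏≮k)) ⟩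
  ι (∏sylvester i) ℚ.* sylvesterTerm i   ≡⟨ ∏*term i ⟩
  1ℚ                                     ∎
  where
  open ℚ.≤-Reasoning
  ∏≮k : ¬ (∏sylvester i ℕ.< k)
  ∏≮k ∏<k = ℚ.<-irrefl refl (begin-strict
    1ℚ                                    ≡⟨ ℚ.+-identityʳ 1ℚ ⟨
    1ℚ ℚ.+ 0ℚ                             <⟨ ℚ.+-monoʳ-< 1ℚ (0<term n) ⟩
    1ℚ ℚ.+ sylvesterTerm n                ≡⟨ sylvester*lightWeight n i ⟨
    ι (sylvester i) ℚ.* lightWeight n i   ≤⟨ *-monoˡ-≤ (lightWeight n i) (ℚ.<⇒≤ (0<lightWeight n i)) (ι-mono-≤ ∏<k) ⟩
    ι k ℚ.* lightWeight n i               ≤⟨ fits ⟩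
    1ℚ                                    ∎)

-- The adversary against a rational ratio below a partial sum.

module Adversary
  (A : OnlineAlgorithm) (n : ℕ) (p : ℚ) (0<p : 0ℚ ℚ.< p) (p<S : p ℚ.< partialSum n)
  (competitive : ∀ {m} (I : Vec ℚItem m) T → totalℚ wt I T ℚ.≤ 1ℚ →
                 totalℚ val I T ℚ.≤ p ℚ.* totalℚ val I (knapsackℚ A I))
  where

  S d B : ℚ
  S = partialSum n
  d = S ℚ.- p
  B = 1ℚ ℚ.+ p ℚ.* S

  0<d : 0ℚ ℚ.< d
  0<d = 0<q-p p<S

  0<S : 0ℚ ℚ.< S
  0<S = ℚ.<-trans 0<p p<S

  0<B : 0ℚ ℚ.< B
  0<B = ℚ.<-≤-trans 0<1 (p≤p+q 1ℚ (ℚ.<⇒≤ (0<p*q 0<p 0<S)))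

  big : ℚItem
  big = mkItem 1ℚ B 0<1 ℚ.≤-refl 0<B

  -- Rounds and items are counted from 0, hence the factor `suc r`, which also keeps the values of
  -- the first round positive.
  light : ℕ → ℕ → ℚItem
  light r i = mkItem (lightWeight n i) (ι (suc r) ℚ.* d ℚ.* sylvesterTerm i)
    (0<lightWeight n i) (lightWeight≤1 n i) (0<p*q (0<p*q (0<ι-suc r) 0<d) (0<term i))

  -- The light items offered once `i` items of round `r` have arrived. The start of a round is by
  -- definition the end of the one before.
  history : ℕ → ℕ → List ℚItem
  history r       (suc i) = light r i ∷ history r i
  history zero    zero    = []
  history (suc r) zero    = history r n

  -- One copy of each light item of the unfinished round; the differences in `recip` telescope.
  current-round : ∀ r i → Packing big (history r i)
    ((1ℚ ℚ.- sylvesterTerm i) ℚ.* (1ℚ ℚ.+ sylvesterTerm n)) (ι (suc r) ℚ.* d ℚ.* partialSum i)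
  -- `sylvesterTerm 0` is 1, so the weight starts at 0.
  current-round r zero = subst₂ (Packing big (history r 0))
    (sym (ℚ.*-zeroˡ (1ℚ ℚ.+ sylvesterTerm n))) (sym (ℚ.*-zeroʳ (ι (suc r) ℚ.* d)))
    (empty-packing big (history r 0))
  current-round r (suc i) = subst₂ (Packing big (history r (suc i)))
    (telescope (sylvesterTerm i) (sylvesterTerm (suc i)) (1ℚ ℚ.+ sylvesterTerm n))
    (sym (ℚ.*-distribˡ-+ (ι (suc r) ℚ.* d) (partialSum i) (sylvesterTerm i)))
    (take big (history r i) (light r i) (current-round r i))
    where
    telescope : ∀ u u′ y → (1ℚ ℚ.- u) ℚ.* y ℚ.+ (u ℚ.- u′) ℚ.* y ≡ (1ℚ ℚ.- u′) ℚ.* y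
    telescope = solve 3 (λ u u′ y → (con 1ℚ :- u) :* y :+ (u :- u′) :* y := (con 1ℚ :- u′) :* y) refl

  Achievable : List ℚItem → ℚ → Set
  Achievable L g = ∃[ w ] (w ℚ.≤ 1ℚ × Packing big L w g)

  -- The packing of the last complete round survives while the next round arrives. Before any round
  -- is complete, the empty packing has the required gain 0.
  previous-round : ∀ r i → Achievable (history r i) (ι r ℚ.* d ℚ.* S)
  previous-round r (suc i) =
    let w , w≤1 , P = previous-round r i
    in w , w≤1 , skip big (history r i) (light r i) P
  previous-round zero zero = 0ℚ , ℚ.<⇒≤ 0<1 ,
    subst (Packing big [] 0ℚ) (sym (trans (cong (ℚ._* S) (ℚ.*-zeroˡ d)) (ℚ.*-zeroˡ S))) (empty-packing big [])
  -- A full round weighs (1 - u)(1 + u) = 1 - u², so the excess of the light weights over 1/a₁, ...,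
  -- 1/aₙ still fits.
  previous-round (suc r) zero = (1ℚ ℚ.- u) ℚ.* (1ℚ ℚ.+ u) , ≤1 , current-round r n
    where
    u = sylvesterTerm n
    square : ∀ u → (1ℚ ℚ.- u) ℚ.* (1ℚ ℚ.+ u) ℚ.+ u ℚ.* u ≡ 1ℚ
    square = solve 1 (λ u → (con 1ℚ :- u) :* (con 1ℚ :+ u) :+ u :* u := con 1ℚ) refl
    ≤1 : (1ℚ ℚ.- u) ℚ.* (1ℚ ℚ.+ u) ℚ.≤ 1ℚ
    ≤1 = subst ((1ℚ ℚ.- u) ℚ.* (1ℚ ℚ.+ u) ℚ.≤_) (square u)
      (p≤p+q ((1ℚ ℚ.- u) ℚ.* (1ℚ ℚ.+ u)) (0≤p*q (ℚ.<⇒≤ (0<term n)) (ℚ.<⇒≤ (0<term n))))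

  only-big : ∀ L → Achievable L B
  only-big L = 1ℚ , ℚ.≤-refl , first-packing big L

  algorithm-gain : List ℚItem → ℚ
  algorithm-gain L = totalℚ val (arrivals big L) (knapsackℚ A (arrivals big L))

  achievable-≤ : ∀ L {g} → Achievable L g → g ℚ.≤ p ℚ.* algorithm-gain L
  achievable-≤ L (w , w≤1 , T , wT≡w , vT≡g) =
    subst (ℚ._≤ p ℚ.* algorithm-gain L) vT≡g
      (competitive (arrivals big L) T (subst (ℚ._≤ 1ℚ) (sym wT≡w) w≤1))

  -- The gain D of a single type of item in round r + 1 is less than r d S / p when D > S,
  -- and less than B / p when D ≤ S.
  no-switch : ∀ r i → ¬ HoldsCopies A big (history r i) (light r i)
  no-switch r i (j , fits , gain≡) = ℚ.<-irrefl refl (begin-strict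
    p ℚ.* S              ≡⟨ ℚ.+-identityˡ (p ℚ.* S) ⟨
    0ℚ ℚ.+ p ℚ.* S       <⟨ ℚ.+-monoˡ-< (p ℚ.* S) 0<1 ⟩
    B                    ≤⟨ achievable-≤ (history r (suc i)) (only-big (history r (suc i))) ⟩
    p ℚ.* algorithm-gain (history r (suc i))   ≤⟨ p*gain≤p*D ⟩
    p ℚ.* D              ≤⟨ *-monoʳ-≤ p (ℚ.<⇒≤ 0<p) D≤S ⟩
    p ℚ.* S              ∎)
    where
    open ℚ.≤-Reasoning
    D = ι (suc r) ℚ.* d
    p*gain≤p*D : p ℚ.* algorithm-gain (history r (suc i)) ℚ.≤ p ℚ.* D
    p*gain≤p*D = *-monoʳ-≤ p (ℚ.<⇒≤ 0<p) (begin
      algorithm-gain (history r (suc i))     ≡⟨ gain≡ ⟩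
      ι j ℚ.* (D ℚ.* sylvesterTerm i)        ≡⟨ swap (ι j) D (sylvesterTerm i) ⟩
      D ℚ.* (ι j ℚ.* sylvesterTerm i)        ≤⟨ *-monoʳ-≤ D (ℚ.<⇒≤ (0<p*q (0<ι-suc r) 0<d)) (copies-worth≤1 n i j fits) ⟩
      D ℚ.* 1ℚ                               ≡⟨ ℚ.*-identityʳ D ⟩
      D                                      ∎)
      where
      swap : ∀ x y z → x ℚ.* (y ℚ.* z) ≡ y ℚ.* (x ℚ.* z)
      swap = solve 3 (λ x y z → x :* (y :* z) := y :* (x :* z)) refl
    D≤S : D ℚ.≤ S
    -- As `D` is (1 + r) d, the product d D equals d S + (r d S - p D). Competitiveness against the
    -- previous round makes the bracket nonpositive.
    D≤S = ℚ.*-cancelˡ-≤-pos d {{positive 0<d}} (begin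
      (S ℚ.- p) ℚ.* D                          ≡⟨ cong (λ k → (S ℚ.- p) ℚ.* (k ℚ.* d)) (ι-homo-+ 1 r) ⟩
      (S ℚ.- p) ℚ.* ((1ℚ ℚ.+ ι r) ℚ.* d)       ≡⟨ expand S p (ι r) d ⟩
      d ℚ.* S ℚ.+ (ι r ℚ.* d ℚ.* S ℚ.- p ℚ.* ((1ℚ ℚ.+ ι r) ℚ.* d))
        ≡⟨ cong (λ k → d ℚ.* S ℚ.+ (ι r ℚ.* d ℚ.* S ℚ.- p ℚ.* (k ℚ.* d))) (ι-homo-+ 1 r) ⟨
      d ℚ.* S ℚ.+ (ι r ℚ.* d ℚ.* S ℚ.- p ℚ.* D)
        ≤⟨ ℚ.+-monoʳ-≤ (d ℚ.* S) (ℚ.+-monoˡ-≤ (ℚ.- (p ℚ.* D))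
             (ℚ.≤-trans (achievable-≤ (history r (suc i)) (previous-round r (suc i))) p*gain≤p*D)) ⟩
      d ℚ.* S ℚ.+ (p ℚ.* D ℚ.- p ℚ.* D)        ≡⟨ cong (d ℚ.* S ℚ.+_) (ℚ.+-inverseʳ (p ℚ.* D)) ⟩
      d ℚ.* S ℚ.+ 0ℚ                           ≡⟨ ℚ.+-identityʳ (d ℚ.* S) ⟩
      d ℚ.* S                                  ∎)
      where
      expand : ∀ S p x d → (S ℚ.- p) ℚ.* ((1ℚ ℚ.+ x) ℚ.* d) ≡
        d ℚ.* S ℚ.+ (x ℚ.* d ℚ.* S ℚ.- p ℚ.* ((1ℚ ℚ.+ x) ℚ.* d))
      expand = solve 4 (λ S p x d → (S :- p) :* ((con 1ℚ :+ x) :* d) :=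
        d :* S :+ (x :* d :* S :- p :* ((con 1ℚ :+ x) :* d))) refl

  -- An empty knapsack would contradict competitiveness, as `B` is positive; two copies would be too
  -- heavy.
  holds-first : HoldsFirst A big []
  holds-first = analyse (knapsackℚ A (big ∷ [])) refl (knapsackℚ-weight A (big ∷ []))
    where
    open ℚ.≤-Reasoning
    analyse : ∀ T → knapsackℚ A (big ∷ []) ≡ T → totalℚ wt (big ∷ []) (knapsackℚ A (big ∷ [])) ℚ.≤ 1ℚ →
      knapsackℚ A (big ∷ []) ≡ 1 ∷ []
    analyse (1 ∷ []) K≡T _ = K≡T
    analyse (0 ∷ []) K≡T _ = ⊥-elim (ℚ.<-irrefl refl (begin-strict
      0ℚ                                      <⟨ 0<B ⟩
      B                                       ≤⟨ achievable-≤ [] (only-big []) ⟩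
      p ℚ.* algorithm-gain []                 ≡⟨ cong (λ T → p ℚ.* totalℚ val (big ∷ []) T) K≡T ⟩
      p ℚ.* totalℚ val (big ∷ []) (0 ∷ [])    ≡⟨ cong (p ℚ.*_) (totalℚ-zeros val (big ∷ [])) ⟩
      p ℚ.* 0ℚ                                ≡⟨ ℚ.*-zeroʳ p ⟩
      0ℚ                                      ∎))
    analyse (suc (suc k) ∷ []) K≡T K≤1 = ⊥-elim (ℚ.<-irrefl refl (begin-strict
      1ℚ                                                    ≡⟨ ℚ.+-identityʳ 1ℚ ⟨
      1ℚ ℚ.+ 0ℚ                                             <⟨ ℚ.+-monoʳ-< 1ℚ (0<ι-suc k) ⟩
      1ℚ ℚ.+ ι (suc k)                                      ≡⟨ ι-homo-+ 1 (suc k) ⟨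
      ι (suc (suc k))                                       ≡⟨ trans (ℚ.+-identityʳ (ι (suc (suc k)) ℚ.* 1ℚ)) (ℚ.*-identityʳ (ι (suc (suc k)))) ⟨
      totalℚ wt (big ∷ []) (suc (suc k) ∷ [])               ≡⟨ cong (totalℚ wt (big ∷ [])) K≡T ⟨
      totalℚ wt (big ∷ []) (knapsackℚ A (big ∷ []))         ≤⟨ K≤1 ⟩
      1ℚ                                                    ∎))

  -- Induction along `history`: every arrival leaves the alternative of `hold-or-switch`, and
  -- `no-switch` excludes its second half.
  never-switches : ∀ r i → HoldsFirst A big (history r i)
  never-switches r       (suc i) = fromInj₁ (λ switches → ⊥-elim (no-switch r i switches))
    (hold-or-switch A big (history r i) (light r i) refl (never-switches r i))
  never-switches zero    zero    = holds-first
  never-switches (suc r) zero    = never-switches r n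

  contradiction : ⊥
  -- After enough rounds the previous round alone is worth more than `p ℚ.* B`, while the gain of
  -- the algorithm is still `B`.
  contradiction = refute (archimedean (p ℚ.* B) (d ℚ.* S) (0<p*q 0<d 0<S))
    where
    open ℚ.≤-Reasoning
    refute : ∃[ r ] p ℚ.* B ℚ.< ι r ℚ.* (d ℚ.* S) → ⊥
    refute (r , pB<rdS) = ℚ.<-irrefl refl (begin-strict
      p ℚ.* B                           <⟨ pB<rdS ⟩
      ι r ℚ.* (d ℚ.* S)                 ≡⟨ ℚ.*-assoc (ι r) d S ⟨
      ι r ℚ.* d ℚ.* S                   ≤⟨ achievable-≤ (history r 0) (previous-round r 0) ⟩
      p ℚ.* algorithm-gain (history r 0)
        ≡⟨ cong (λ T → p ℚ.* totalℚ val (arrivals big (history r 0)) T) (never-switches r 0) ⟩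
      p ℚ.* totalℚ val (arrivals big (history r 0)) (1 ∷ replicate _ 0)
        ≡⟨ cong (p ℚ.*_) (totalℚ-first val big (history r 0)) ⟩
      p ℚ.* B                           ∎)

-- From rational ratios to the competitive ratio.

partialSum≤ratio : ∀ A {c p} → 1ℝ ≤ c → Competitive c A → c < fromℚ p → ∀ n → partialSum n ℚ.≤ p
partialSum≤ratio A {c} {p} 1≤c comp c<p n = ℚ.≮⇒≥ λ p<S →
  Adversary.contradiction A n p 0<p p<S (competitiveℚ {c} {p} {A} comp c<p)
  where
  0<p : 0ℚ ℚ.< p
  -- If `p` were at most 1, then `c` would lie below 1.
  0<p = ℚ.<-trans 0<1 (ℚ.≰⇒> λ p≤1 → 1≤c (upward (fromℝ c) p≤1 c<p))

theorem3 : (A : OnlineAlgorithm) → ¬ (competitiveRatio A <∞ fromℝ S∞)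
theorem3 A (q , (c , (1≤c , comp) , c<q) , S∞≮q) =
  -- Bounding the partial sums by `q` would not make `S∞` strictly smaller than `q`. A rational `p`
  -- strictly between `c` and `q` bounds them too, and `q ℚ.- p` is then a gap that works for every
  -- `n`.
  let p , p<q , c<p = rounded (fromℝ c) c<q
  in S∞≮q (q ℚ.- p , 0<q-p p<q , 0 , λ n _ → ℚ.≤-trans
       (ℚ.+-monoˡ-≤ (q ℚ.- p) (partialSum≤ratio A {c} {p} 1≤c comp c<p n))
       (ℚ.≤-reflexive (p+[q-p]≡q p q)))
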